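{- Let $\theta=p/q\in(0,1]$, where $p,q\in\mathbb{N}$, $q$ is odd, and $\Upsilon(p,q)=2$. Let $\mathcal{G}(\theta)=(a_n)_{n=1}^\infty$. Then $$a_1=\frac{q+2}{p},\qquad a_2=\left\lfloor\frac{qa_1}{2}\right\rfloor+1,$$ and $$\frac{p}{q}-\sum_{i=1}^{n-1}\frac{1}{a_i}=\frac{1}{q\prod_{i=1}^{n-1}a_i},\quad n\geqslant 3.$$ Hence, $$a_n=q\prod_{i=1}^{n-1}a_i+1,\quad n\geqslant 3.$$
   Context: $\mathbb{N}$ is the set of positive integers. For $p,q\in\mathbb{N}$, $\Upsilon(p,q)$ is the smallest positive integer $m$ such that $p$ divides $q+m$. For $\theta\in(0,1]$ let $G(\theta)=\lfloor 1/\theta\rfloor+1$. The greedy algorithm $\mathcal{G}$ produces the sequence $\mathcal{G}(\theta)=(a_n)_{n=1}^\infty$ of positive integers defined by $a_1=G(\theta)$ and $a_m=G\left(\theta-\sum_{n=1}^{m-1}1/a_n\right)$ for $m\geqslant 2$. -}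

module Defs where

open import Data.Nat.Base as ℕ using (ℕ; zero; suc; pred; NonZero; z≤n; s≤s; z<s)
import Data.Nat.Properties as ℕ
import Data.Nat.DivMod as ℕ
open import Data.Nat.Divisibility using (_∣_; _∣?_; m∣m*n; n∣n; ∣m∣n⇒∣m+n)
open import Data.Integer.Base as ℤ using (ℤ; +_; 1ℤ)
import Data.Integer.Properties as ℤ
open import Data.Rational.Base hiding (NonZero)
import Data.Rational.Properties as ℚ
open import Data.Rational.Unnormalised.Base as ℚᵘ using (mkℚᵘ)
import Data.Rational.Unnormalised.Properties as ℚᵘ
open import Data.Product using (∃; _×_; _,_; proj₁; proj₂)
open import Relation.Binary.PropositionalEquality
open import Relation.Nullary using (yes; no; contradiction)
open import Relation.Nullary.Decidable using (_×-dec_)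
open import Relation.Unary using (Pred; Decidable)
open import Level using (0ℓ)

-- Sequences are indexed from 1: the index carries a proof that it is non-zero.

Seq : Set → Set
Seq A = (i : ℕ) .{{_ : NonZero i}} → A

∑ : ℕ → Seq ℚ → ℚ
∑ zero    f = 0ℚ
∑ (suc k) f = ∑ k f + f (suc k)

∏ : ℕ → Seq ℕ → ℕ
∏ zero    f = 1
∏ (suc k) f = ∏ k f ℕ.* f (suc k)

syntax ∑ k (λ i → x) = ∑[1≤ i ≤ k ] x
syntax ∏ k (λ i → x) = ∏[1≤ i ≤ k ] x

IsLeast : Pred ℕ 0ℓ → Pred ℕ 0ℓ
IsLeast P m = P m × (∀ k → P k → m ℕ.≤ k)

least : {P : Pred ℕ 0ℓ} → Decidable P → ∀ n → P n → ∃ (IsLeast P)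
least P? zero    P0 = 0 , P0 , λ _ _ → z≤n
least {P} P? (suc n) Pn with P? 0
... | yes P0 = 0 , P0 , λ _ _ → z≤n
... | no ¬P0 with least {λ k → P (suc k)} (λ k → P? (suc k)) n Pn
...   | m , Pm , min = suc m , Pm , λ where
  zero    P0 → contradiction P0 ¬P0
  (suc k) Pk → s≤s (min k Pk)

Υ-Candidate : ℕ → ℕ → Pred ℕ 0ℓ
Υ-Candidate p q m = 0 ℕ.< m × p ∣ q ℕ.+ m

Υ-exists : ∀ p q .{{_ : NonZero p}} → ∃ (IsLeast (Υ-Candidate p q))
Υ-exists p@(suc p′) q =
  least (λ m → (0 ℕ.<? m) ×-dec (p ∣? q ℕ.+ m)) (p′ ℕ.* q ℕ.+ p)
    ( ℕ.<-≤-trans z<s (ℕ.m≤n+m p (p′ ℕ.* q))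
    , subst (p ∣_) (ℕ.+-assoc q (p′ ℕ.* q) p) (∣m∣n⇒∣m+n (m∣m*n {p} q) n∣n))

Υ : ∀ p q .{{_ : NonZero p}} → ℕ
Υ p q = proj₁ (Υ-exists p q)

-- 1/θ is positive, so taking the absolute value of its (integer) floor only
-- moves it to ℕ; see G-floor.

G : (θ : ℚ) .{{_ : Positive θ}} → ℕ
G θ = suc ℤ.∣ floor ((1/ θ) {{ℚ.pos⇒nonZero θ}}) ∣

G-floor : ∀ θ .{{_ : Positive θ}} →
          + G θ ≡ floor ((1/ θ) {{ℚ.pos⇒nonZero θ}}) ℤ.+ 1ℤ
G-floor (mkℚ ℤ.+[1+ n ] d-1 _)
  rewrite ℤ.*-identityˡ (+ (suc d-1 ℕ./ suc n)) = cong +_ (ℕ.+-comm 1 (suc d-1 ℕ./ suc n))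

1/G<θ : ∀ θ .{{_ : Positive θ}} → + 1 / G θ < θ
1/G<θ θ@(mkℚ ℤ.+[1+ n ] d-1 _) = ℚ.toℚᵘ-cancel-< (ℚᵘ.<-respˡ-≃
  (ℚᵘ.≃-sym (ℚ.toℚᵘ-fromℚᵘ (mkℚᵘ (+ 1) (pred (G θ)))))
  (ℚᵘ.*<* (subst₂ ℤ._<_ (sym (ℤ.*-identityˡ (+ d))) (ℤ.pos-* (suc n) (G θ)) (ℤ.+<+ d<nG))))
  where
  d = suc d-1
  G≡ : G θ ≡ suc (d ℕ./ suc n)
  G≡ = cong (λ z → suc ℤ.∣ z ∣) (ℤ.*-identityˡ (+ (d ℕ./ suc n)))
  d<nG : d ℕ.< suc n ℕ.* G θ
  d<nG = begin-strict
    d                                              ≡⟨ ℕ.m≡m%n+[m/n]*n d (suc n) ⟩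
    d ℕ.% suc n ℕ.+ (d ℕ./ suc n) ℕ.* suc n        <⟨ ℕ.+-monoˡ-< _ (ℕ.m%n<n d (suc n)) ⟩
    suc (d ℕ./ suc n) ℕ.* suc n                    ≡⟨ ℕ.*-comm (suc (d ℕ./ suc n)) (suc n) ⟩
    suc n ℕ.* suc (d ℕ./ suc n)                    ≡⟨ cong (suc n ℕ.*_) (sym G≡) ⟩
    suc n ℕ.* G θ                                  ∎
    where open ℕ.≤-Reasoning

p<q⇒0<q-p : ∀ {p q} → p < q → 0ℚ < q - p
p<q⇒0<q-p {p} {q} p<q = subst (_< q - p) (ℚ.+-inverseʳ p) (ℚ.+-monoˡ-< (- p) p<q)

-- 𝒢₀ θ m is a_{m+1}, and partialSum θ m is 1/a₁ + ⋯ + 1/aₘ.  The partial sums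
-- are defined together with the sequence because the recursion needs
-- θ - partialSum θ m to be positive; 𝒢-rec restates it with ∑.

𝒢₀         : (θ : ℚ) .{{_ : Positive θ}} → ℕ → ℕ
partialSum : (θ : ℚ) .{{_ : Positive θ}} → ℕ → ℚ
rest-pos   : ∀ θ .{{_ : Positive θ}} m → Positive (θ - partialSum θ m)

𝒢₀ θ m = G (θ - partialSum θ m) {{rest-pos θ m}}

partialSum θ zero    = 0ℚ
partialSum θ (suc m) = partialSum θ m + + 1 / 𝒢₀ θ m

rest-pos θ {{θ>0}} zero    = subst (λ x → Positive x) (sym (ℚ.+-identityʳ θ)) (relevant θ)
  where
  relevant : ∀ x .{{_ : Positive x}} → Positive x
  relevant (mkℚ ℤ.+[1+ _ ] _ _) = _
rest-pos θ (suc m) = positive (subst (0ℚ <_) eq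
  (p<q⇒0<q-p (1/G<θ (θ - s) {{rest-pos θ m}})))
  where
  s = partialSum θ m
  r = + 1 / 𝒢₀ θ m
  eq : (θ - s) - r ≡ θ - (s + r)
  eq = trans (ℚ.+-assoc θ (- s) (- r)) (cong (λ x → θ + x) (sym (ℚ.neg-distrib-+ s r)))

𝒢 : (θ : ℚ) .{{_ : Positive θ}} → Seq ℕ
𝒢 θ (suc m) = 𝒢₀ θ m

instance
  𝒢-nonZero : ∀ {θ} .{{_ : Positive θ}} {n} .{{_ : NonZero n}} → NonZero (𝒢 θ n)
  𝒢-nonZero {n = suc _} = _

∏𝒢-nonZero : ∀ θ .{{_ : Positive θ}} k → NonZero (∏ k (𝒢 θ))
∏𝒢-nonZero θ zero    = _
∏𝒢-nonZero θ (suc k) = ℕ.m*n≢0 (∏ k (𝒢 θ)) (𝒢 θ (suc k)) {{∏𝒢-nonZero θ k}}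

q∏𝒢-nonZero : ∀ q .{{_ : NonZero q}} θ .{{_ : Positive θ}} k →
              NonZero (q ℕ.* ∏ k (𝒢 θ))
q∏𝒢-nonZero q θ k = ℕ.m*n≢0 q (∏ k (𝒢 θ))
  where instance
    ∏≢0 : NonZero (∏ k (𝒢 θ))
    ∏≢0 = ∏𝒢-nonZero θ k

partialSum-∑ : ∀ θ .{{_ : Positive θ}} m →
               partialSum θ m ≡ (∑[1≤ i ≤ m ] (+ 1 / 𝒢 θ i))
partialSum-∑ θ zero    = refl
partialSum-∑ θ (suc m) = cong (λ s → s + + 1 / 𝒢₀ θ m) (partialSum-∑ θ m)

remainder : (θ : ℚ) .{{_ : Positive θ}} → ℕ → ℚ
remainder θ m = θ - (∑[1≤ i ≤ m ] (+ 1 / 𝒢 θ i))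

remainder-pos : ∀ θ .{{_ : Positive θ}} m → Positive (remainder θ m)
remainder-pos θ m = subst (λ s → Positive (θ - s)) (partialSum-∑ θ m) (rest-pos θ m)

𝒢-rec : ∀ θ .{{_ : Positive θ}} m →
        𝒢 θ (suc m) ≡ G (remainder θ m) {{remainder-pos θ m}}
𝒢-rec θ m = G-cong {{rest-pos θ m}} {{remainder-pos θ m}}
  (cong (λ s → θ - s) (partialSum-∑ θ m))
  where
  G-cong : ∀ {x y} .{{_ : Positive x}} .{{_ : Positive y}} → x ≡ y → G x ≡ G y
  G-cong refl = refl

instance
  /-positive : ∀ {p q} .{{_ : NonZero p}} .{{_ : NonZero q}} → Positive (+ p / q)
  /-positive {p} {q} = ℚ.normalize-pos p q

{-# OPTIONS --safe #-}

-- Write each remainder p/q − Σ_{i≤k} 1/a_i over the denominator q a₁ ⋯ a_k.  If it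
-- is m/D and m a = D + r with 0 < r ≤ m, then the greedy choice is a, and the next
-- remainder is (m a − D)/(D a) = r/(D a).  The numerators are p, 2, 1, 1, 1, …:
-- p a₁ = q + 2 with 2 ≤ p by the choice of Υ, then q a₁ is odd so that
-- 2 a₂ = q a₁ + 1, and from there on 1 · (D + 1) = D + 1.

module Submission where

open import Defs
open import Data.Nat.Base as ℕ using (ℕ; zero; suc; NonZero; z≤n; s≤s; z<s)
import Data.Nat.Properties as ℕ
import Data.Nat.DivMod as ℕ
open import Data.Nat.Divisibility
  using (_∣_; quotient; m∣n⇒n≡m*quotient; 1∣_; m∣m*n; n∣n; ∣n⇒∣m*n; ∣m+n∣m⇒∣n; m%n≡0⇒n∣m)
open import Data.Nat.Primality using (prime[2]; euclidsLemma)
import Data.Nat.Tactic.RingSolver as ℕ-Solver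
open import Data.Integer.Base as ℤ using (+_)
import Data.Integer.Properties as ℤ
open import Data.Rational.Base
  using (ℚ; mkℚ; 1ℚ; _/_; _+_; _-_; -_; _≤_; Positive; toℚᵘ)
import Data.Rational.Properties as ℚ
open import Data.Rational.Unnormalised.Base as ℚᵘ using (mkℚᵘ; *≡*)
import Data.Rational.Unnormalised.Properties as ℚᵘ
open import Algebra.Properties.Group ℚ.+-0-group using (x≈z//y)
open import Data.Product using (_×_; _,_; proj₁; proj₂)
open import Data.Sum using ([_,_])
open import Relation.Binary.PropositionalEquality
  using (_≡_; refl; sym; trans; cong; cong₂; subst; module ≡-Reasoning)
open import Relation.Nullary using (¬_; contradiction)

-- With `a = b + 1`, cancelling `r` leaves `d = (m - r) + m * b`, and `0 < r ≤ m` makes `m - r` a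
-- valid remainder. The case `r = m`, where `m` divides `d`, is included because the greedy choice
-- is strict.
/-unique : ∀ {m d a r} .{{_ : NonZero m}} .{{_ : NonZero r}} →
           r ℕ.≤ m → m ℕ.* a ≡ d ℕ.+ r → suc (d ℕ./ m) ≡ a
/-unique {m} {d} {zero} {suc r} _ eq =
  contradiction (trans (sym eq) (ℕ.*-zeroʳ m)) (ℕ.m+1+n≢0 d)
-- Here `s` is `m - r`, with `m` replaced by `r + s` to avoid truncated subtraction.
/-unique {m} {d} {suc b} {r} r≤m eq with s , refl ← ℕ.m≤n⇒∃[o]m+o≡n r≤m =
  cong suc (begin
    d ℕ./ m                        ≡⟨ ℕ./-congˡ d≡ ⟩
    (s ℕ.+ m ℕ.* b) ℕ./ m          ≡⟨ ℕ.+-distrib-/-∣ʳ s (m∣m*n b) ⟩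
    s ℕ./ m ℕ.+ m ℕ.* b ℕ./ m      ≡⟨ cong₂ ℕ._+_ (ℕ.m<n⇒m/n≡0 s<m) m*b/m≡b ⟩
    b                              ∎)
  where
  open ≡-Reasoning
  s<m : s ℕ.< m
  s<m = ℕ.m<n+m s (ℕ.>-nonZero⁻¹ r)
  m*b/m≡b : m ℕ.* b ℕ./ m ≡ b
  m*b/m≡b = trans (ℕ./-congˡ (ℕ.*-comm m b)) (ℕ.m*n/n≡m b m)
  d≡ : d ≡ s ℕ.+ m ℕ.* b
  d≡ = ℕ.+-cancelʳ-≡ r d _ (begin
    d ℕ.+ r                        ≡⟨ eq ⟨
    m ℕ.* suc b                    ≡⟨ ℕ.*-suc m b ⟩
    r ℕ.+ s ℕ.+ m ℕ.* b            ≡⟨ ℕ.+-assoc r s (m ℕ.* b) ⟩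
    r ℕ.+ (s ℕ.+ m ℕ.* b)          ≡⟨ ℕ.+-comm r _ ⟩
    s ℕ.+ m ℕ.* b ℕ.+ r            ∎)

n%2≡1 : ∀ {n} → ¬ (2 ∣ n) → n ℕ.% 2 ≡ 1
n%2≡1 {n} 2∤n with n ℕ.% 2 in eq | ℕ.m%n<n n 2
... | 0 | _ = contradiction (m%n≡0⇒n∣m n 2 eq) 2∤n
... | 1 | _ = refl
... | suc (suc _) | s≤s (s≤s ())

-- Writing `n = 1 + 2h`, both sides are `2h + 2`. This is the equation that the second greedy step
-- needs, with `n` the denominator `q * a₁`.
2*⌈odd/2⌉ : ∀ {n} → ¬ (2 ∣ n) → 2 ℕ.* (n ℕ./ 2 ℕ.+ 1) ≡ n ℕ.+ 1
2*⌈odd/2⌉ {n} 2∤n = begin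
  2 ℕ.* (n ℕ./ 2 ℕ.+ 1)                ≡⟨ double (n ℕ./ 2) ⟩
  1 ℕ.+ n ℕ./ 2 ℕ.* 2 ℕ.+ 1            ≡⟨ cong (λ r → r ℕ.+ n ℕ./ 2 ℕ.* 2 ℕ.+ 1) (n%2≡1 2∤n) ⟨
  n ℕ.% 2 ℕ.+ n ℕ./ 2 ℕ.* 2 ℕ.+ 1      ≡⟨ cong (ℕ._+ 1) (ℕ.m≡m%n+[m/n]*n n 2) ⟨
  n ℕ.+ 1                              ∎
  where
  open ≡-Reasoning
  double : ∀ h → 2 ℕ.* (h ℕ.+ 1) ≡ 1 ℕ.+ h ℕ.* 2 ℕ.+ 1
  double = ℕ-Solver.solve-∀

Υ≡2⇒ : ∀ p q .{{_ : NonZero p}} → Υ p q ≡ 2 → 2 ℕ.≤ p × p ∣ q ℕ.+ 2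
Υ≡2⇒ p q Υ≡2
  with (_ , p∣q+2) , least₂ ← subst (IsLeast (Υ-Candidate p q)) Υ≡2 (proj₂ (Υ-exists p q))
  = ℕ.≤∧≢⇒< (ℕ.>-nonZero⁻¹ p) 1≢p , p∣q+2
  where
  1≢p : ¬ (1 ≡ p)
  -- If `p` were 1, then 1 would be a candidate smaller than the least one, 2.
  1≢p refl with s≤s () ← least₂ 1 (z<s , 1∣ _)

-- The floor is computed from the reduced form `n/e` of `θ`, whereas `m/d` may be unreduced.
-- Expanding `e/n` by `m` and `d/m` by `n` gives the same fraction, since `m * e = n * d`.
G-≡ : ∀ θ m d .{{_ : Positive θ}} .{{_ : NonZero m}} .{{_ : NonZero d}} →
      θ ≡ + m / d → G θ ≡ suc (d ℕ./ m)
G-≡ θ@(mkℚ ℤ.+[1+ n ] e-1 _) m@(suc _) d@(suc d-1) θ≡m/d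
  with *≡* nd≡me ← ℚᵘ.≃-trans (ℚᵘ.≃-reflexive (cong toℚᵘ θ≡m/d)) (ℚ.toℚᵘ-fromℚᵘ (mkℚᵘ (+ m) d-1))
  = cong suc (begin
    ℤ.∣ + 1 ℤ.* + (e ℕ./ suc n) ∣       ≡⟨ cong ℤ.∣_∣ (ℤ.*-identityˡ (+ (e ℕ./ suc n))) ⟩
    e ℕ./ suc n                         ≡⟨ ℕ.m*n/m*o≡n/o m e (suc n) ⟨
    (m ℕ.* e) ℕ./ (m ℕ.* suc n)         ≡⟨ ℕ./-congˡ {o = m ℕ.* suc n} me≡nd ⟩
    (suc n ℕ.* d) ℕ./ (m ℕ.* suc n)     ≡⟨ ℕ./-congʳ {m = suc n ℕ.* d} (ℕ.*-comm m (suc n)) ⟩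
    (suc n ℕ.* d) ℕ./ (suc n ℕ.* m)     ≡⟨ ℕ.m*n/m*o≡n/o (suc n) d m ⟩
    d ℕ./ m                             ∎)
  where
  open ≡-Reasoning
  e : ℕ
  e = suc e-1
  me≡nd : m ℕ.* e ≡ suc n ℕ.* d
  me≡nd = sym (ℤ.+-injective nd≡me)

-- The numerator of the difference is `m * a - d = r`. Proving the additive form
-- `r/(d * a) + 1/a = m/d` instead reduces everything to a cross-multiplication in ℕ.
m/d-1/a : ∀ m d a r .{{_ : NonZero d}} .{{_ : NonZero a}} → m ℕ.* a ≡ d ℕ.+ r →
          + m / d - + 1 / a ≡ (+ r / (d ℕ.* a)) {{ℕ.m*n≢0 d a}}
m/d-1/a m d@(suc d-1) a@(suc a-1) r ma≡d+r =
  sym (x≈z//y _ _ _ (ℚ.toℚᵘ-injective (begin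
    toℚᵘ (+ r / (d ℕ.* a) + + 1 / a)
      ≈⟨ ℚ.toℚᵘ-homo-+ (+ r / (d ℕ.* a)) (+ 1 / a) ⟩
    toℚᵘ (+ r / (d ℕ.* a)) ℚᵘ.+ toℚᵘ (+ 1 / a)
      ≈⟨ ℚᵘ.+-cong (ℚ.toℚᵘ-fromℚᵘ (+ r ℚᵘ./ (d ℕ.* a))) (ℚ.toℚᵘ-fromℚᵘ (+ 1 ℚᵘ./ a)) ⟩
    + r ℚᵘ./ (d ℕ.* a) ℚᵘ.+ + 1 ℚᵘ./ a
      ≈⟨ *≡* cross ⟩
    + m ℚᵘ./ d
      ≈⟨ ℚ.toℚᵘ-fromℚᵘ (+ m ℚᵘ./ d) ⟨
    toℚᵘ (+ m / d) ∎)))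
  where
  open import Relation.Binary.Reasoning.Setoid ℚᵘ.≃-setoid
  cross-ℕ : (r ℕ.* a ℕ.+ 1 ℕ.* (d ℕ.* a)) ℕ.* d ≡ m ℕ.* (d ℕ.* a ℕ.* a)
  cross-ℕ = trans (trans (lhs r a d) (cong (λ x → x ℕ.* (d ℕ.* a)) (sym ma≡d+r))) (rhs m a d)
    where
    lhs : ∀ r a d → (r ℕ.* a ℕ.+ 1 ℕ.* (d ℕ.* a)) ℕ.* d ≡ (d ℕ.+ r) ℕ.* (d ℕ.* a)
    lhs = ℕ-Solver.solve-∀
    rhs : ∀ m a d → m ℕ.* a ℕ.* (d ℕ.* a) ≡ m ℕ.* (d ℕ.* a ℕ.* a)
    rhs = ℕ-Solver.solve-∀
  cross : (+ r ℤ.* + a ℤ.+ + 1 ℤ.* + (d ℕ.* a)) ℤ.* + d ≡ + m ℤ.* + (d ℕ.* a ℕ.* a)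
  cross rewrite sym (ℤ.pos-* r a) | sym (ℤ.pos-* 1 (d ℕ.* a))
              | sym (ℤ.pos-* (r ℕ.* a ℕ.+ 1 ℕ.* (d ℕ.* a)) d)
              | sym (ℤ.pos-* m (d ℕ.* a ℕ.* a)) = cong +_ cross-ℕ

n/1≡ : ∀ {p a n} .{{_ : NonZero p}} → p ℕ.* a ≡ n → + a / 1 ≡ + n / p
n/1≡ {p@(suc p-1)} {a} {n} pa≡n = ℚ.fromℚᵘ-cong {mkℚᵘ (+ a) 0} {mkℚᵘ (+ n) p-1} (*≡* (begin
  + a ℤ.* + p     ≡⟨ ℤ.pos-* a p ⟨
  + (a ℕ.* p)     ≡⟨ cong +_ (trans (ℕ.*-comm a p) pa≡n) ⟩
  + n             ≡⟨ ℤ.*-identityʳ (+ n) ⟨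
  + n ℤ.* + 1     ∎))
  where open ≡-Reasoning

remainder-suc : ∀ θ .{{_ : Positive θ}} k →
                remainder θ (suc k) ≡ remainder θ k - + 1 / 𝒢 θ (suc k)
remainder-suc θ k = begin
  θ - (s + t)      ≡⟨ cong (λ x → θ + x) (ℚ.neg-distrib-+ s t) ⟩
  θ + (- s - t)    ≡⟨ ℚ.+-assoc θ (- s) (- t) ⟨
  θ - s - t        ∎
  where
  open ≡-Reasoning
  s = ∑[1≤ i ≤ k ] (+ 1 / 𝒢 θ i)
  t = + 1 / 𝒢 θ (suc k)

-- θ stays abstract because + p / q unfolds to a gcd computation, and normalising
-- the greedy terms of that blows up.

module Greedy (q : ℕ) .{{_ : NonZero q}} (θ : ℚ) .{{_ : Positive θ}} where

  denominator : ℕ → ℕ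
  denominator k = q ℕ.* ∏ k (𝒢 θ)

  infixl 7 _/denominator_

  _/denominator_ : ℕ → ℕ → ℚ
  m /denominator k = (+ m / denominator k) {{q∏𝒢-nonZero q θ k}}

  -- `G-≡` and `/-unique` identify the greedy term with `a`; only then does `ma≡` become an equation
  -- about that term, from which `m/d-1/a` gives the next remainder.
  step : ∀ k m r a .{{_ : NonZero m}} .{{_ : NonZero r}} →
         remainder θ k ≡ m /denominator k →
         r ℕ.≤ m → m ℕ.* a ≡ denominator k ℕ.+ r →
         𝒢 θ (suc k) ≡ a × remainder θ (suc k) ≡ r /denominator (suc k)
  step k m r a rem≡ r≤m ma≡ = 𝒢≡a , (begin
    remainder θ (suc k)                        ≡⟨ remainder-suc θ k ⟩
    remainder θ k - + 1 / 𝒢 θ (suc k)          ≡⟨ cong (λ x → x - + 1 / 𝒢 θ (suc k)) rem≡ ⟩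
    m /denominator k - + 1 / 𝒢 θ (suc k)
      ≡⟨ m/d-1/a m (denominator k) (𝒢 θ (suc k)) r (trans (cong (m ℕ.*_) 𝒢≡a) ma≡) ⟩
    (+ r / (denominator k ℕ.* 𝒢 θ (suc k))) {{ℕ.m*n≢0 (denominator k) _}}
      ≡⟨ ℚ./-cong {+ r} {{ℕ.m*n≢0 (denominator k) _}} {{q∏𝒢-nonZero q θ (suc k)}} refl (ℕ.*-assoc q _ _) ⟩
    r /denominator (suc k)                     ∎)
    where
    open ≡-Reasoning
    instance
      D≢0 : NonZero (denominator k)
      D≢0 = q∏𝒢-nonZero q θ k
    𝒢≡a : 𝒢 θ (suc k) ≡ a
    𝒢≡a = begin
      𝒢 θ (suc k)                             ≡⟨ 𝒢-rec θ k ⟩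
      G (remainder θ k) {{remainder-pos θ k}}
        ≡⟨ G-≡ (remainder θ k) m (denominator k) {{remainder-pos θ k}} rem≡ ⟩
      suc (denominator k ℕ./ m)               ≡⟨ /-unique r≤m ma≡ ⟩
      a                                       ∎

  -- Numerator 1 is a fixed point of the recursion: with `m = r = 1` the step reproduces its own
  -- hypothesis.
  step-1 : ∀ k → remainder θ k ≡ 1 /denominator k →
           𝒢 θ (suc k) ≡ denominator k ℕ.+ 1 ×
           remainder θ (suc k) ≡ 1 /denominator (suc k)
  step-1 k rem≡ = step k 1 1 _ rem≡ ℕ.≤-refl (ℕ.*-identityˡ _)

  -- `≤′` grows at its upper end, so each constructor is one further greedy step after `k₀`.
  remainder-from : ∀ {k₀ k} → k₀ ℕ.≤′ k → remainder θ k₀ ≡ 1 /denominator k₀ →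
                   remainder θ k ≡ 1 /denominator k
  remainder-from ℕ.≤′-refl                rem≡ = rem≡
  remainder-from (ℕ.≤′-step {n = k} k₀≤k) rem≡ = proj₂ (step-1 k (remainder-from k₀≤k rem≡))

  module Expansion {p a : ℕ} .{{_ : NonZero p}}
                   (θ≡p/q : θ ≡ + p / q) (2∤q : ¬ (2 ∣ q))
                   (2≤p : 2 ℕ.≤ p) (pa≡q+2 : p ℕ.* a ≡ q ℕ.+ 2) where

    denominator-0 : denominator 0 ≡ q
    denominator-0 = ℕ.*-identityʳ q

    denominator-1 : denominator 1 ≡ q ℕ.* 𝒢 θ 1
    denominator-1 = cong (q ℕ.*_) (ℕ.*-identityˡ (𝒢 θ 1))

    step₁ : 𝒢 θ 1 ≡ a × remainder θ 1 ≡ 2 /denominator 1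
    -- The new numerator is `r = 2`, so the bound `r ≤ m` is `2 ≤ p`. The empty product leaves the
    -- denominator `q * 1`, hence the transports along `denominator-0`.
    step₁ = step 0 p 2 a
      (trans (trans (ℚ.+-identityʳ θ) θ≡p/q) (ℚ./-cong {+ p} refl (sym denominator-0)))
      2≤p
      (trans pa≡q+2 (cong (ℕ._+ 2) (sym denominator-0)))
      where instance
        D≢0 : NonZero (denominator 0)
        D≢0 = q∏𝒢-nonZero q θ 0

    a₁≡a : 𝒢 θ 1 ≡ a
    a₁≡a = proj₁ step₁

    -- An even `a` would make `p * a = q + 2` even, and hence `q` even.
    2∤a : ¬ (2 ∣ a)
    2∤a 2∣a = 2∤q (∣m+n∣m⇒∣n
      (subst (2 ∣_) (trans pa≡q+2 (ℕ.+-comm q 2)) (∣n⇒∣m*n p 2∣a)) n∣n)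

    2∤denominator-1 : ¬ (2 ∣ denominator 1)
    2∤denominator-1 2∣d = [ 2∤q , 2∤a ]
      (euclidsLemma q a prime[2] (subst (2 ∣_) (trans denominator-1 (cong (q ℕ.*_) a₁≡a)) 2∣d))

    step₂ : 𝒢 θ 2 ≡ denominator 1 ℕ./ 2 ℕ.+ 1 × remainder θ 2 ≡ 1 /denominator 2
    -- As the denominator is odd, twice the greedy term exceeds it by exactly 1, so the numerator
    -- drops from 2 to 1.
    step₂ = step 1 2 1 _ (proj₂ step₁) (s≤s z≤n) (2*⌈odd/2⌉ 2∤denominator-1)

    a₂≡ : 𝒢 θ 2 ≡ (q ℕ.* 𝒢 θ 1) ℕ./ 2 ℕ.+ 1
    a₂≡ = trans (proj₁ step₂) (cong (λ d → d ℕ./ 2 ℕ.+ 1) denominator-1)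

    remainder≡ : ∀ n .{{_ : NonZero n}} → 3 ℕ.≤ n →
                 remainder θ (n ℕ.∸ 1) ≡ 1 /denominator (n ℕ.∸ 1)
    -- With `n = k + 1`, the bound `3 ≤ n` says that at least the two exceptional terms have been
    -- subtracted.
    remainder≡ (suc k) (s≤s 2≤k) = remainder-from (ℕ.≤⇒≤′ 2≤k) (proj₂ step₂)

    aₙ≡ : ∀ n .{{_ : NonZero n}} → 3 ℕ.≤ n → 𝒢 θ n ≡ denominator (n ℕ.∸ 1) ℕ.+ 1
    aₙ≡ (suc k) 3≤n = proj₁ (step-1 k (remainder≡ (suc k) 3≤n))

proposition1p10 :
  (p q : ℕ) .{{_ : NonZero p}} .{{_ : NonZero q}} →
  + p / q ≤ 1ℚ →
  ¬ (2 ∣ q) →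
  Υ p q ≡ 2 →
  let a : Seq ℕ
      a = 𝒢 (+ p / q)
  in
    (+ a 1 / 1 ≡ + (q ℕ.+ 2) / p) ×
    (a 2 ≡ (q ℕ.* a 1) ℕ./ 2 ℕ.+ 1) ×
    (∀ n .{{_ : NonZero n}} → 3 ℕ.≤ n →
      + p / q - (∑[1≤ i ≤ n ℕ.∸ 1 ] (+ 1 / a i))
        ≡ (+ 1 / (q ℕ.* (∏[1≤ i ≤ n ℕ.∸ 1 ] a i))) {{q∏𝒢-nonZero q (+ p / q) (n ℕ.∸ 1)}}) ×
    (∀ n .{{_ : NonZero n}} → 3 ℕ.≤ n →
      a n ≡ q ℕ.* (∏[1≤ i ≤ n ℕ.∸ 1 ] a i) ℕ.+ 1)
proposition1p10 p q _ 2∤q Υ≡2 =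
  trans (cong (λ x → + x / 1) a₁≡a) (n/1≡ pa≡q+2) , a₂≡ , remainder≡ , aₙ≡
  where
  p∣q+2 : p ∣ q ℕ.+ 2
  p∣q+2 = proj₂ (Υ≡2⇒ p q Υ≡2)
  pa≡q+2 : p ℕ.* quotient p∣q+2 ≡ q ℕ.+ 2
  pa≡q+2 = sym (m∣n⇒n≡m*quotient p∣q+2)
  -- Only here is the abstract `θ` specialised to `+ p / q`; the quotient of `q + 2` by `p` serves
  -- as `a`.
  open Greedy.Expansion q (+ p / q) refl 2∤q (proj₁ (Υ≡2⇒ p q Υ≡2)) pa≡q+2
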